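{- For each AARM $M$, the language $L(M)$ is recursively enumerable.
   Context: For a finite alphabet $\Gamma$ and a symbol $\# \notin \Gamma$, the convolution $conv(x,y)$ of $x,y\in\Gamma^*$ is the string of length $\max(|x|,|y|)$ over $(\Gamma\cup\{\#\})^2$ whose $i$-th letter is $(x'_i,y'_i)$, where $x',y'$ are $x,y$ padded on the right with $\#$ to equal length. A relation $J\subseteq\Gamma^*\times\Gamma^*$ is automatic if $\{conv(x,y):(x,y)\in J\}$ is regular, and bounded if there is a constant $c$ with $||y|-|x||\le c$ for all $(x,y)\in J$. An Alternating Automatic Register Machine (AARM) $M=(\Gamma,\Sigma,A,B)$ consists of a register alphabet $\Gamma$, an input alphabet $\Sigma\subseteq\Gamma$ and two finite sets $A,B$ of instructions, each a bounded automatic relation $J\subseteq\Gamma^*\times\Gamma^*$. On input $w\in\Sigma^*$ the register initially contains $w$, and two players, Anke and Boris, move alternately, Anke first: on her turn, if the register contains $r$, Anke chooses $J\in A$ and some $x$ with $(r,x)\in J$, and the register then contains $x$; Boris moves in the same way using instructions from $B$. If the player to move has no instruction $J$ in their set with some $x$ such that $(r,x)\in J$, the game ends and the player who made the last move wins; an infinite play is a draw. $M$ accepts $w$ if Anke has a winning strategy, and $L(M)=\{w\in\Sigma^*: M \text{ accepts } w\}$. -}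

module Defs where

open import Data.Nat using (ℕ; _≤_; _+_)
open import Data.Fin using (Fin)
open import Data.Fin.Subset using (Subset; _∈_)
open import Data.Bool using (Bool; true)
open import Data.List using (List; []; _∷_; foldl; length)
open import Data.List.Relation.Unary.All using (All)
open import Data.Maybe using (Maybe; just; nothing)
open import Data.Product using (Σ; ∃; _×_; _,_)
open import Function.Bundles using (_⇔_)
open import Relation.Binary.PropositionalEquality using (_≡_)

-- Padding symbol # is represented by `nothing`.
-- Convolution of two words: pad the shorter one on the right with #.
conv : {X : Set} → List X → List X → List (Maybe X × Maybe X)
conv []       []       = []
conv (a ∷ x)  []       = (just a , nothing) ∷ conv x []
conv []       (b ∷ y)  = (nothing , just b) ∷ conv [] y
conv (a ∷ x)  (b ∷ y)  = (just a , just b) ∷ conv x y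

record DFA (X : Set) : Set where
  field
    nStates : ℕ
    start   : Fin nStates
    δ       : Fin nStates → X → Fin nStates
    final   : Fin nStates → Bool

accepts : {X : Set} → DFA X → List X → Bool
accepts D w = DFA.final D (foldl (DFA.δ D) (DFA.start D) w)

Word : ℕ → Set
Word k = List (Fin k)

Automatic : {k : ℕ} → (Word k → Word k → Set) → Set
Automatic {k} J =
  Σ (DFA (Maybe (Fin k) × Maybe (Fin k))) λ D →
    ∀ x y → J x y ⇔ (accepts D (conv x y) ≡ true)

Bounded : {k : ℕ} → (Word k → Word k → Set) → Set
Bounded {k} J =
  Σ ℕ λ c → ∀ x y → J x y → (length y ≤ length x + c) × (length x ≤ length y + c)

record Instruction (k : ℕ) : Set₁ where
  field
    rel       : Word k → Word k → Set
    automatic : Automatic rel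
    bounded   : Bounded rel

-- An AARM (Γ, Σ, A, B) with Γ = Fin k, Σ ⊆ Γ, and finite instruction sets
-- A (Anke) and B (Boris), each given as a finite indexed family.
record AARM : Set₁ where
  field
    k      : ℕ
    Σin    : Subset k
    nA     : ℕ
    A      : Fin nA → Instruction k
    nB     : ℕ
    B      : Fin nB → Instruction k

module _ (M : AARM) where
  open AARM M

  -- If Boris has no reply, the game
  -- ends and Anke (last mover) wins; this is the vacuous case.
  -- Being inductive, this forces a win in finitely many moves
  -- (infinite plays are draws, not wins).
  data AnkeWins (r : Word k) : Set where
    win : (i : Fin nA) (x : Word k) →
          Instruction.rel (A i) r x →
          (∀ (j : Fin nB) (y : Word k) → Instruction.rel (B j) x y → AnkeWins y) →
          AnkeWins r

  Lang : Word k → Set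
  Lang w = All (_∈ Σin) w × AnkeWins w

-- Recursive enumerability (synthetic computability): a language is r.e. if
-- there is a (necessarily computable, as every Agda function is) total
-- function f with  w ∈ L  ⇔  ∃ n, f w n = true.
RecEnum : {X : Set} → (List X → Set) → Set
RecEnum {X} L = Σ (List X → ℕ → Bool) λ f → ∀ w → L w ⇔ (∃ λ n → f w n ≡ true)

-- Let Wₙ be the set of registers from which Anke can force a win within n
-- rounds.  Every instruction is decidable (a DFA reads the convolution) and,
-- being bounded, allows only finitely many successors of a given register,
-- all of length at most |r| + c.  Hence each Wₙ is decidable by exhaustive
-- search.  Conversely a winning strategy is a well-founded, finitely
-- branching tree, so it has a finite depth n and its root lies in Wₙ.
-- Thus L(M) = ⋃ₙ (Σ* ∩ Wₙ) is a union of a computable chain of decidable sets.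
module Submission where

open import Defs
open import Data.Nat using (ℕ; zero; suc; _≤_; _+_; _⊔_; z≤n; s≤s)
open import Data.Nat.Properties using (≤-trans; +-monoʳ-≤; m≤m⊔n; m≤n⊔m)
open import Data.Fin using (Fin)
open import Data.Fin.Properties using (any?)
open import Data.Fin.Subset as Subset using ()
open import Data.Fin.Subset.Properties using (_∈?_)
open import Data.Bool using (true)
open import Data.Bool.Properties using (T-≡) renaming (_≟_ to _≟ᵇ_)
open import Data.Empty using (⊥; ⊥-elim)
open import Data.List using (List; []; _∷_; [_]; length; allFin; cartesianProductWith)
open import Data.List.Membership.Propositional using (_∈_; lose)
open import Data.List.Membership.Propositional.Properties
  using (∈-allFin; ∈-cartesianProductWith⁺)
open import Data.List.Relation.Unary.All as All using (All; []; _∷_)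
open import Data.List.Relation.Unary.Any as Any using (here; there)
open import Data.Product using (∃; _×_; _,_; proj₁)
open import Function.Bundles using (_⇔_; mk⇔; Equivalence)
open import Relation.Binary.Definitions using () renaming (Decidable to Decidable₂)
open import Relation.Binary.PropositionalEquality using (refl)
open import Relation.Nullary using (Dec; yes; no)
open import Relation.Nullary.Decidable
  using (map′; isYes; toWitness; fromWitness; _×-dec_; _→-dec_)
open import Relation.Unary using (Decidable)

recEnum-∃-decidable : {X : Set} {L : List X → Set} (P : List X → ℕ → Set) →
                      (∀ w n → Dec (P w n)) → (∀ w → L w ⇔ ∃ (P w)) → RecEnum L
recEnum-∃-decidable P P? L⇔∃P =
  (λ w n → isYes (P? w n)) , λ w → mk⇔
    (λ Lw → let n , p = Equivalence.to (L⇔∃P w) Lw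
            in n , Equivalence.to T-≡ (fromWitness p))
    (λ (n , accepted) →
       Equivalence.from (L⇔∃P w) (n , toWitness (Equivalence.from T-≡ accepted)))

module _ {A : Set} where

  Monotone : (ℕ → A → Set) → Set
  Monotone P = ∀ {m n x} → m ≤ n → P m x → P n x

  common-bound : {P : ℕ → A → Set} → Monotone P →
                 ∀ {xs} → All (λ x → ∃ λ n → P n x) xs → ∃ λ n → All (P n) xs
  common-bound mono []                     = 0 , []
  common-bound mono ((m , px) ∷ ∃P-rest) with common-bound mono ∃P-rest
  ... | n , P-rest = m ⊔ n , mono (m≤m⊔n m n) px ∷ All.map (mono (m≤n⊔m m n)) P-rest

  record FinitelyBranching (R : A → A → Set) : Set where
    field
      successors   : A → List A
      ∈-successors : ∀ {x y} → R x y → y ∈ successors x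

  module _ {R : A → A → Set} (fb : FinitelyBranching R) (R? : Decidable₂ R) where
    open FinitelyBranching fb

    ∃-successor? : {P : A → Set} → Decidable P → ∀ x → Dec (∃ λ y → R x y × P y)
    ∃-successor? P? x =
      map′ Any.satisfied (λ (y , rxy , py) → lose (∈-successors rxy) (rxy , py))
           (Any.any? (λ y → R? x y ×-dec P? y) (successors x))

    ∀-successor? : {P : A → Set} → Decidable P → ∀ x → Dec (∀ y → R x y → P y)
    ∀-successor? P? x =
      map′ (λ all y rxy → All.lookup all (∈-successors rxy) rxy)
           (λ all → All.tabulate (λ {y} _ → all y))
           (All.all? (λ y → R? x y →-dec P? y) (successors x))

    -- Deciding R x y is what lets each successor candidate pick its own stage.
    common-bound-successors : {P : ℕ → A → Set} → Monotone P →
                              ∀ {x} → (∀ y → R x y → ∃ λ n → P n y) →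
                              ∃ λ n → ∀ y → R x y → P n y
    common-bound-successors {P} mono {x} ∃P =
      let n , P-all = common-bound (λ m≤n p rxy → mono m≤n (p rxy))
                                   (All.tabulate {xs = successors x} (λ {y} _ → stage y))
      in n , λ y rxy → All.lookup P-all (∈-successors rxy) rxy
      where
      stage : ∀ y → ∃ λ n → R x y → P n y
      stage y with R? x y
      ... | yes rxy = let n , p = ∃P y rxy in n , λ _ → p
      ... | no ¬rxy = 0 , λ rxy → ⊥-elim (¬rxy rxy)

module _ {k : ℕ} where

  wordsUpTo : ℕ → List (Word k)
  wordsUpTo zero    = [ [] ]
  wordsUpTo (suc m) = [] ∷ cartesianProductWith _∷_ (allFin k) (wordsUpTo m)

  ∈-wordsUpTo : ∀ {m} (x : Word k) → length x ≤ m → x ∈ wordsUpTo m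
  ∈-wordsUpTo {zero}  []      z≤n       = here refl
  ∈-wordsUpTo {suc m} []      _         = here refl
  ∈-wordsUpTo {suc m} (a ∷ x) (s≤s |x|≤m) =
    there (∈-cartesianProductWith⁺ _∷_ (∈-allFin a) (∈-wordsUpTo x |x|≤m))

  GrowthBounded : (Word k → Word k → Set) → Set
  GrowthBounded R = ∃ λ c → ∀ {x y} → R x y → length y ≤ length x + c

  growthBounded⇒finitelyBranching : {R : Word k → Word k → Set} →
                                    GrowthBounded R → FinitelyBranching R
  growthBounded⇒finitelyBranching (c , bound) = record
    { successors   = λ x → wordsUpTo (length x + c)
    ; ∈-successors = λ {_} {y} rxy → ∈-wordsUpTo y (bound rxy)
    }

  automatic⇒decidable : {J : Word k → Word k → Set} → Automatic J → Decidable₂ J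
  automatic⇒decidable (D , J⇔accepts) x y =
    map′ (Equivalence.from (J⇔accepts x y)) (Equivalence.to (J⇔accepts x y))
         (accepts D (conv x y) ≟ᵇ true)

module _ {k n : ℕ} (I : Fin n → Instruction k) where
  open Instruction

  Step : Word k → Word k → Set
  Step r x = ∃ λ i → rel (I i) r x

  step? : Decidable₂ Step
  step? r x = any? (λ i → automatic⇒decidable (automatic (I i)) r x)

  step-growthBounded : GrowthBounded Step
  step-growthBounded =
    let c , bound = common-bound
                      (λ c≤d bound {x} {y} rxy → ≤-trans (bound rxy) (+-monoʳ-≤ (length x) c≤d))
                      (All.tabulate {xs = allFin n} (λ {i} _ → upper i))
    in c , λ (i , rxy) → All.lookup bound (∈-allFin i) rxy
    where
    upper : ∀ i → ∃ λ c → ∀ {x y} → rel (I i) x y → length y ≤ length x + c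
    upper i = let c , bound = bounded (I i) in c , λ {x} {y} rxy → proj₁ (bound x y rxy)

  step-finitelyBranching : FinitelyBranching Step
  step-finitelyBranching = growthBounded⇒finitelyBranching step-growthBounded

module _ (M : AARM) where
  open AARM M

  AnkeForces : (Word k → Set) → Word k → Set
  AnkeForces W r = ∃ λ x → Step A r x × ∀ y → Step B x y → W y

  WinsWithin : ℕ → Word k → Set
  WinsWithin zero    _ = ⊥
  WinsWithin (suc n)   = AnkeForces (WinsWithin n)

  ankeForces? : {W : Word k → Set} → Decidable W → Decidable (AnkeForces W)
  ankeForces? W? = ∃-successor? (step-finitelyBranching A) (step? A)
                     (∀-successor? (step-finitelyBranching B) (step? B) W?)

  winsWithin? : ∀ n → Decidable (WinsWithin n)
  winsWithin? zero    _ = no (λ ())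
  winsWithin? (suc n)   = ankeForces? (winsWithin? n)

  winsWithin-mono : Monotone WinsWithin
  winsWithin-mono {suc m} {suc n} (s≤s m≤n) (x , ankeMove , wins) =
    x , ankeMove , λ y borisMove → winsWithin-mono m≤n (wins y borisMove)

  winsWithin⇒ankeWins : ∀ n {r} → WinsWithin n r → AnkeWins M r
  winsWithin⇒ankeWins (suc n) (x , (i , rx) , wins) =
    win i x rx (λ j y xy → winsWithin⇒ankeWins n (wins y (j , xy)))

  ankeWins⇒winsWithin : ∀ {r} → AnkeWins M r → ∃ λ n → WinsWithin n r
  ankeWins⇒winsWithin (win i x rx wins) =
    let n , wins-n = common-bound-successors (step-finitelyBranching B) (step? B)
                       winsWithin-mono (λ y (j , xy) → ankeWins⇒winsWithin (wins j y xy))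
    in suc n , x , (i , rx) , wins-n

  lang⇔winsWithin : ∀ w → Lang M w ⇔ ∃ λ n → All (λ a → a Subset.∈ Σin) w × WinsWithin n w
  lang⇔winsWithin w = mk⇔
    (λ (w∈Σ* , ankeWins) → let n , wins = ankeWins⇒winsWithin ankeWins in n , w∈Σ* , wins)
    (λ (n , w∈Σ* , wins) → w∈Σ* , winsWithin⇒ankeWins n wins)

proposition2 : (M : AARM) → RecEnum (Lang M)
proposition2 M = recEnum-∃-decidable _
  (λ w n → All.all? (_∈? Σin) w ×-dec winsWithin? M n w) (lang⇔winsWithin M)
  where open AARM M
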